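{- Let $\varphi:\mathbb{N}^{\mathbb{N}}\to\mathbb{N}$ be any type two functional. There is no functional $\Theta$ satisfying $\textsf{SFF}(\Theta)$ that is computable in $\varphi$.
   Context: The metatheory is $\textsf{ZFC}$ and functionals live in the full (set-theoretic) type structure over $\mathbb{N}$. "Computable" (in given functionals) means Kleene computable via the schemes S1–S9. For $f\in\mathbb{N}^{\mathbb{N}}$, $\overline{f}N=\langle f(0),\dots,f(N-1)\rangle$; for a finite sequence $\sigma$, $f\in[\sigma]$ means $f$ extends $\sigma$. A functional $\Theta$ of type $2\to1^*$ assigns to every $G:\mathbb{N}^{\mathbb{N}}\to\mathbb{N}$ a finite sequence $\Theta(G)=\langle f_0,\dots,f_k\rangle$ of elements of $\mathbb{N}^{\mathbb{N}}$. $\textsf{SFF}(\Theta)$ ("$\Theta$ is a special fan functional") is the statement: for all $G:\mathbb{N}^{\mathbb{N}}\to\mathbb{N}$ and all $f\in2^{\mathbb{N}}$ there is an entry $g$ of $\Theta(G)$ with $f\in[\overline{g}G(g)]$. That such a $\Theta$ is computable means that the (suitably coded) map giving the length of $\Theta(G)$ and the values $\Theta(G)(i)(n)$ is computable. -}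

module Defs where

open import Data.Fin.Base using (Fin; toℕ)
open import Data.List.Base using (List; []; _∷_; length; lookup; take; applyUpTo)
open import Data.List.Membership.Propositional using (_∈_)
open import Data.List.Relation.Unary.All as All using (All; []; _∷_)
open import Data.List.Relation.Unary.All.Properties using (─⁺; take⁺)
open import Data.List.Relation.Unary.Any as Any using (Any; _─_)
open import Data.Nat.Base using (ℕ; zero; suc; _+_; _*_; _^_; _<_)
open import Data.Product.Base using (Σ-syntax; _×_)
open import Relation.Binary.PropositionalEquality.Core using (_≡_)

-- The pure types.  In the presence of excluded middle (for all small types)
-- and function extensionality, Agda's function types play the role of the
-- full set-theoretic type structure over ℕ.
Pure : ℕ → Set
Pure zero    = ℕ
Pure (suc j) = Pure j → ℕ

-- Argument lists; Γ is the list of the pure types of the arguments.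
Args : List ℕ → Set
Args = All Pure

-- Indices for Kleene's schemes, for argument lists of type Γ.
-- S4: ψ(χ(a), a).  S5: primitive recursion on the first argument.
-- S6: move one argument to the front.  S8: α(λ ξ. χ(α, ξ, b)) with α of type
-- j + 2 and ξ of type j.  S9: {x}(b), where b consists of the first m of the
-- arguments following x.
data Index : List ℕ → Set where
  S1 : ∀ {Γ} → Index (0 ∷ Γ)
  S2 : ∀ {Γ} (q : ℕ) → Index Γ
  S3 : ∀ {Γ} → Index (0 ∷ Γ)
  S4 : ∀ {Γ} (g : Index (0 ∷ Γ)) (h : Index Γ) → Index Γ
  S5 : ∀ {Γ} (g : Index Γ) (h : Index (0 ∷ 0 ∷ Γ)) → Index (0 ∷ Γ)
  S6 : ∀ {Γ j} (p : j ∈ Γ) (g : Index (j ∷ (Γ ─ p))) → Index Γ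
  S7 : ∀ {Γ} → Index (1 ∷ 0 ∷ Γ)
  S8 : ∀ {Γ j} (h : Index (2 + j ∷ j ∷ Γ)) → Index (2 + j ∷ Γ)
  S9 : ∀ {Γ} (m : Fin (suc (length Γ))) → Index (0 ∷ Γ)

-- A bijective coding of finite sequences of numbers by numbers.
⟪_⟫ : List ℕ → ℕ
⟪ [] ⟫     = 0
⟪ x ∷ xs ⟫ = 2 ^ x * (1 + 2 * ⟪ xs ⟫)

-- The numerical index; as in Kleene's definition it records the scheme and the
-- types Γ of the arguments.
code : ∀ {Γ} → Index Γ → ℕ
code {Γ} S1       = ⟪ 1 ∷ ⟪ Γ ⟫ ∷ [] ⟫
code {Γ} (S2 q)   = ⟪ 2 ∷ ⟪ Γ ⟫ ∷ q ∷ [] ⟫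
code {Γ} S3       = ⟪ 3 ∷ ⟪ Γ ⟫ ∷ [] ⟫
code {Γ} (S4 g h) = ⟪ 4 ∷ ⟪ Γ ⟫ ∷ code g ∷ code h ∷ [] ⟫
code {Γ} (S5 g h) = ⟪ 5 ∷ ⟪ Γ ⟫ ∷ code g ∷ code h ∷ [] ⟫
code {Γ} (S6 p g) = ⟪ 6 ∷ ⟪ Γ ⟫ ∷ toℕ (Any.index p) ∷ code g ∷ [] ⟫
code {Γ} S7       = ⟪ 7 ∷ ⟪ Γ ⟫ ∷ [] ⟫
code {Γ} (S8 h)   = ⟪ 8 ∷ ⟪ Γ ⟫ ∷ code h ∷ [] ⟫
code {Γ} (S9 m)   = ⟪ 9 ∷ ⟪ Γ ⟫ ∷ toℕ m ∷ [] ⟫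

infix 4 ｛_｝_≃_

-- ｛ e ｝ a ≃ y: the Kleene computation with index e and arguments a converges
-- with value y.  In S8 the inner computation has to converge for every ξ.  In
-- S9 the computation converges only if the number x codes an index for
-- argument lists of the required type.
data ｛_｝_≃_ : ∀ {Γ} → Index Γ → Args Γ → ℕ → Set where
  s1 : ∀ {Γ x} {b : Args Γ} → ｛ S1 ｝ x ∷ b ≃ suc x
  s2 : ∀ {Γ q} {a : Args Γ} → ｛ S2 q ｝ a ≃ q
  s3 : ∀ {Γ x} {b : Args Γ} → ｛ S3 ｝ x ∷ b ≃ x
  s4 : ∀ {Γ g h y z} {a : Args Γ} →
       ｛ h ｝ a ≃ z → ｛ g ｝ z ∷ a ≃ y → ｛ S4 g h ｝ a ≃ y
  s5-zero : ∀ {Γ g h y} {b : Args Γ} →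
       ｛ g ｝ b ≃ y → ｛ S5 g h ｝ zero ∷ b ≃ y
  s5-suc : ∀ {Γ g h x y z} {b : Args Γ} →
       ｛ S5 g h ｝ x ∷ b ≃ z → ｛ h ｝ x ∷ z ∷ b ≃ y →
       ｛ S5 g h ｝ suc x ∷ b ≃ y
  s6 : ∀ {Γ j y} {p : j ∈ Γ} {g : Index (j ∷ (Γ ─ p))} {a : Args Γ} →
       ｛ g ｝ All.lookup a p ∷ ─⁺ p a ≃ y → ｛ S6 p g ｝ a ≃ y
  s7 : ∀ {Γ x} {α : Pure 1} {b : Args Γ} → ｛ S7 ｝ α ∷ x ∷ b ≃ α x
  s8 : ∀ {Γ j h} {α : Pure (2 + j)} {b : Args Γ} (F : Pure (1 + j)) →
       (∀ ξ → ｛ h ｝ α ∷ ξ ∷ b ≃ F ξ) → ｛ S8 h ｝ α ∷ b ≃ α F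
  s9 : ∀ {Γ m x y} {b : Args Γ} (d : Index (take (toℕ m) Γ)) →
       code d ≡ x → ｛ d ｝ take⁺ (toℕ m) b ≃ y → ｛ S9 m ｝ x ∷ b ≃ y

infix 8 _↾_
infix 4 _∈[_]

_↾_ : (ℕ → ℕ) → ℕ → List ℕ
f ↾ N = applyUpTo f N

_∈[_] : (ℕ → ℕ) → List ℕ → Set
f ∈[ σ ] = f ↾ length σ ≡ σ

Binary : (ℕ → ℕ) → Set
Binary f = ∀ n → f n < 2

SFF : (Pure 2 → List (ℕ → ℕ)) → Set
SFF Θ = ∀ (G : Pure 2) (f : ℕ → ℕ) → Binary f → Any (λ g → f ∈[ g ↾ G g ]) (Θ G)

infix 4 _ComputableIn_

-- One index for the length of Θ(G) and one for its values Θ(G)(i)(n), both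
-- uniform in G; nothing is required of the second one when i is out of range.
_ComputableIn_ : (Pure 2 → List (ℕ → ℕ)) → Pure 2 → Set
Θ ComputableIn φ =
  (Σ[ l ∈ Index (2 ∷ 2 ∷ []) ] ∀ G →
     ｛ l ｝ G ∷ φ ∷ [] ≃ length (Θ G)) ×
  (Σ[ v ∈ Index (0 ∷ 0 ∷ 2 ∷ 2 ∷ []) ] ∀ G (i : Fin (length (Θ G))) n →
     ｛ v ｝ toℕ i ∷ n ∷ G ∷ φ ∷ [] ≃ lookup (Θ G) i n)

{-# OPTIONS --safe #-}

-- Every computation in G and φ asks G only about functions that are themselves
-- computable in G and φ.  So build a partial G by transfinite recursion: at
-- each stage, a function F that has just become computable receives the value
-- e + 1, where e is the least number of a description of F.  Limits of
-- ω-sequences of stages suffice, because a computation branches over ℕ.  The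
-- union over all stages is single-valued and defined on every function that is
-- computable from it and φ, in particular on all entries of Θ(G).  A binary h
-- that differs at e from the function with number e then lies in no
-- neighbourhood [ḡ G(g)] given by an entry g of Θ(G).
module Submission where

open import Defs
open import Axiom.ExcludedMiddle using (ExcludedMiddle)
open import Axiom.Extensionality.Propositional using (Extensionality)
open import Data.Empty using (⊥; ⊥-elim)
open import Data.Fin.Base using (Fin; toℕ)
open import Data.Fin.Properties using (toℕ-injective)
open import Data.List.Base using (List; []; _∷_; length; lookup; take; applyUpTo)
open import Data.List.Membership.Propositional using (_∈_)
open import Data.List.Properties using (∷-injective; ∷-injectiveˡ; ∷-injectiveʳ; length-applyUpTo)
open import Data.List.Relation.Unary.All as All using (All; []; _∷_)
open import Data.List.Relation.Unary.All.Properties using (─⁺; take⁺)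
open import Data.List.Relation.Unary.Any as Any using (here; there; _─_)
open import Data.List.Relation.Unary.Any.Properties using (lookup-index)
open import Data.Nat.Base using (ℕ; zero; suc; _+_; _*_; _^_; _<_; z<s; s<s; ≢-nonZero⁻¹)
open import Data.Nat.Induction using (<-rec)
open import Data.Nat.Properties
  using (*-identityˡ; *-assoc; *-cancelˡ-≡; suc-injective; even≢odd; m*n≢0; m^n≢0; <-cmp; n<1+n)
open import Data.Product.Base using (Σ-syntax; ∃-syntax; _×_; _,_; proj₁; proj₂)
open import Data.Sum.Base using (_⊎_; inj₁; inj₂)
open import Function.Base using (_∘_)
open import Level using (0ℓ)
open import Relation.Binary.Definitions using (tri<; tri≈; tri>)
open import Relation.Binary.PropositionalEquality
  using (_≡_; refl; sym; trans; cong; cong₂; subst)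
open import Relation.Nullary.Decidable.Core using (Dec; yes; no)
open import Relation.Nullary.Negation.Core using (¬_; contradiction)

private
  variable
    Γ Δ : List ℕ
    j : ℕ

-- Injectivity of the coding of indices

-- Parity separates exponent zero from a positive exponent; common factors 2 are cancelled by
-- induction.
2^-*-odd-injective : ∀ x y m n → 2 ^ x * (1 + 2 * m) ≡ 2 ^ y * (1 + 2 * n) → x ≡ y × m ≡ n
2^-*-odd-injective zero zero m n eq = refl , *-cancelˡ-≡ m n 2 (suc-injective
  (trans (sym (*-identityˡ _)) (trans eq (*-identityˡ _))))
2^-*-odd-injective zero (suc y) m n eq = ⊥-elim (even≢odd (2 ^ y * (1 + 2 * n)) m
  (trans (sym (*-assoc 2 (2 ^ y) _)) (trans (sym eq) (*-identityˡ _))))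
2^-*-odd-injective (suc x) zero m n eq = ⊥-elim (even≢odd (2 ^ x * (1 + 2 * m)) n
  (trans (sym (*-assoc 2 (2 ^ x) _)) (trans eq (*-identityˡ _))))
2^-*-odd-injective (suc x) (suc y) m n eq
  with 2^-*-odd-injective x y m n (*-cancelˡ-≡ _ _ 2
         (trans (sym (*-assoc 2 (2 ^ x) _)) (trans eq (*-assoc 2 (2 ^ y) _))))
... | refl , eq′ = refl , eq′

⟪∷⟫≢0 : ∀ x xs → ¬ ⟪ x ∷ xs ⟫ ≡ 0
⟪∷⟫≢0 x xs = ≢-nonZero⁻¹ _ {{m*n≢0 (2 ^ x) (1 + 2 * ⟪ xs ⟫) {{m^n≢0 2 x}}}}

⟪⟫-injective : ∀ xs ys → ⟪ xs ⟫ ≡ ⟪ ys ⟫ → xs ≡ ys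
⟪⟫-injective []       []       eq = refl
⟪⟫-injective []       (y ∷ ys) eq = contradiction (sym eq) (⟪∷⟫≢0 y ys)
⟪⟫-injective (x ∷ xs) []       eq = contradiction eq (⟪∷⟫≢0 x xs)
⟪⟫-injective (x ∷ xs) (y ∷ ys) eq with 2^-*-odd-injective x y ⟪ xs ⟫ ⟪ ys ⟫ eq
... | refl , eq′ = cong (x ∷_) (⟪⟫-injective xs ys eq′)

scheme : Index Γ → ℕ
scheme S1       = 1
scheme (S2 _)   = 2
scheme S3       = 3
scheme (S4 _ _) = 4
scheme (S5 _ _) = 5
scheme (S6 _ _) = 6
scheme S7       = 7
scheme (S8 _)   = 8
scheme (S9 _)   = 9

fields : Index Γ → List ℕ
fields S1       = []
fields (S2 q)   = q ∷ []
fields S3       = []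
fields (S4 g h) = code g ∷ code h ∷ []
fields (S5 g h) = code g ∷ code h ∷ []
fields (S6 p g) = toℕ (Any.index p) ∷ code g ∷ []
fields S7       = []
fields (S8 h)   = code h ∷ []
fields (S9 m)   = toℕ m ∷ []

code-fields : (d : Index Γ) → code d ≡ ⟪ scheme d ∷ ⟪ Γ ⟫ ∷ fields d ⟫
code-fields S1       = refl
code-fields (S2 _)   = refl
code-fields S3       = refl
code-fields (S4 _ _) = refl
code-fields (S5 _ _) = refl
code-fields (S6 _ _) = refl
code-fields S7       = refl
code-fields (S8 _)   = refl
code-fields (S9 _)   = refl

-- The contexts may differ a priori; they agree because every code stores `⟪ Γ ⟫`.
code-fields-injective : (d : Index Γ) (d′ : Index Δ) → code d ≡ code d′ →
  scheme d ≡ scheme d′ × Γ ≡ Δ × fields d ≡ fields d′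
code-fields-injective {Γ} {Δ} d d′ eq
  with ∷-injective (⟪⟫-injective _ _ (trans (sym (code-fields d)) (trans eq (code-fields d′))))
... | s , eq′ with ∷-injective eq′
... | t , f = s , ⟪⟫-injective Γ Δ t , f

-- The code of `S6 p g` stores only the position of the moved argument, so its type has to be
-- recovered together with `p`.
position-injective : ∀ {i} (p : i ∈ Γ) (q : j ∈ Γ) → toℕ (Any.index p) ≡ toℕ (Any.index q) →
  _≡_ {A = Σ[ k ∈ ℕ ] k ∈ Γ} (i , p) (j , q)
position-injective (here refl) (here refl) eq = refl
position-injective (there p)   (there q)   eq with position-injective p q (suc-injective eq)
... | refl = refl

code-injective : (d d′ : Index Γ) → code d ≡ code d′ → d ≡ d′
-- Pairs of different constructors drop out because their scheme numbers differ.
fields-injective : (d d′ : Index Γ) → scheme d ≡ scheme d′ → fields d ≡ fields d′ → d ≡ d′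

code-injective d d′ eq with code-fields-injective d d′ eq
... | s , _ , f = fields-injective d d′ s f

fields-injective S1       S1         refl eq = refl
fields-injective (S2 q)   (S2 q′)    refl eq = cong S2 (∷-injectiveˡ eq)
fields-injective S3       S3         refl eq = refl
fields-injective (S4 g h) (S4 g′ h′) refl eq
  with code-injective g g′ (∷-injectiveˡ eq) | code-injective h h′ (∷-injectiveˡ (∷-injectiveʳ eq))
... | refl | refl = refl
fields-injective (S5 g h) (S5 g′ h′) refl eq
  with code-injective g g′ (∷-injectiveˡ eq) | code-injective h h′ (∷-injectiveˡ (∷-injectiveʳ eq))
... | refl | refl = refl
fields-injective (S6 p g) (S6 q g′)  refl eq with position-injective p q (∷-injectiveˡ eq)
... | refl = cong (S6 p) (code-injective g g′ (∷-injectiveˡ (∷-injectiveʳ eq)))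
fields-injective S7       S7         refl eq = refl
fields-injective (S8 h)   (S8 h′)    refl eq = cong S8 (code-injective h h′ (∷-injectiveˡ eq))
fields-injective (S9 m)   (S9 m′)    refl eq = cong S9 (toℕ-injective (∷-injectiveˡ eq))

-- Computations with a partial oracle

data Oracle : Set where
  given built : Oracle

-- Starting from numbers and type two arguments, Kleene's schemes create
-- no arguments of other types.
Sym : ℕ → Set
Sym 0 = ℕ
Sym 2 = Oracle
Sym _ = ⊥

symCode : ∀ j → Sym j → ℕ
symCode 0 x     = x
symCode 2 given = 0
symCode 2 built = 1

symCode-injective : ∀ j (x y : Sym j) → symCode j x ≡ symCode j y → x ≡ y
symCode-injective 0 x     y     eq = eq
symCode-injective 2 given given eq = refl
symCode-injective 2 built built eq = refl

argCodes : All Sym Γ → List ℕ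
argCodes []      = []
argCodes (x ∷ a) = symCode _ x ∷ argCodes a

argCodes-injective : (a b : All Sym Γ) → argCodes a ≡ argCodes b → a ≡ b
argCodes-injective []      []      eq = refl
argCodes-injective (x ∷ a) (y ∷ b) eq
  with symCode-injective _ x y (∷-injectiveˡ eq) | argCodes-injective a b (∷-injectiveʳ eq)
... | refl | refl = refl

Rel : Set₁
Rel = (ℕ → ℕ) → ℕ → Set

infix 4 _⊆_
_⊆_ : Rel → Rel → Set
R ⊆ S = ∀ {f e} → R f e → S f e

Functional : Rel → Set
Functional R = ∀ {f e e′} → R f e → R f e′ → e ≡ e′

-- R f e means that the partial functional built has the value e + 1 at f.
Answer : Pure 2 → Rel → Oracle → Rel
Answer φ R given f y = y ≡ φ f
Answer φ R built f y = ∃[ e ] (R f e × y ≡ suc e)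

-- `S7` has no clause since `Sym 1` is empty, and only the instance `j = 0` of `S8` remains. A query
-- has to satisfy `Answer`, so `R` may be partial.
data Run (φ : Pure 2) (R : Rel) : Index Γ → All Sym Γ → ℕ → Set where
  s1 : ∀ {x} {b : All Sym Γ} → Run φ R S1 (x ∷ b) (suc x)
  s2 : ∀ {q} {a : All Sym Γ} → Run φ R (S2 q) a q
  s3 : ∀ {x} {b : All Sym Γ} → Run φ R S3 (x ∷ b) x
  s4 : ∀ {g h y z} {a : All Sym Γ} →
       Run φ R h a z → Run φ R g (z ∷ a) y → Run φ R (S4 g h) a y
  s5-zero : ∀ {g h y} {b : All Sym Γ} →
       Run φ R g b y → Run φ R (S5 g h) (zero ∷ b) y
  s5-suc : ∀ {g h x y z} {b : All Sym Γ} →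
       Run φ R (S5 g h) (x ∷ b) z → Run φ R h (x ∷ z ∷ b) y →
       Run φ R (S5 g h) (suc x ∷ b) y
  s6 : ∀ {y} {p : j ∈ Γ} {g : Index (j ∷ (Γ ─ p))} {a : All Sym Γ} →
       Run φ R g (All.lookup a p ∷ ─⁺ p a) y → Run φ R (S6 p g) a y
  s8 : ∀ {h α y} {b : All Sym Γ} (F : ℕ → ℕ) →
       (∀ ξ → Run φ R h (α ∷ ξ ∷ b) (F ξ)) → Answer φ R α F y →
       Run φ R (S8 h) (α ∷ b) y
  s9 : ∀ {m x y} {b : All Sym Γ} (d : Index (take (toℕ m) Γ)) →
       code d ≡ x → Run φ R d (take⁺ (toℕ m) b) y → Run φ R (S9 m) (x ∷ b) y

module _ {φ : Pure 2} where

  Answer-mono : ∀ {R S} → R ⊆ S → ∀ α {f y} → Answer φ R α f y → Answer φ S α f y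
  Answer-mono R⊆S given eq           = eq
  Answer-mono R⊆S built (e , r , eq) = e , R⊆S r , eq

  Run-mono : ∀ {R S} → R ⊆ S → ∀ {h : Index Γ} {a y} → Run φ R h a y → Run φ S h a y
  Run-mono R⊆S s1                 = s1
  Run-mono R⊆S s2                 = s2
  Run-mono R⊆S s3                 = s3
  Run-mono R⊆S (s4 r t)           = s4 (Run-mono R⊆S r) (Run-mono R⊆S t)
  Run-mono R⊆S (s5-zero r)        = s5-zero (Run-mono R⊆S r)
  Run-mono R⊆S (s5-suc r t)       = s5-suc (Run-mono R⊆S r) (Run-mono R⊆S t)
  Run-mono R⊆S (s6 r)             = s6 (Run-mono R⊆S r)
  Run-mono R⊆S (s8 {α = α} F r t) = s8 F (λ ξ → Run-mono R⊆S (r ξ)) (Answer-mono R⊆S α t)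
  Run-mono R⊆S (s9 d eq r)        = s9 d eq (Run-mono R⊆S r)

  Answer-functional : ∀ {R} → Functional R → ∀ α → Functional (Answer φ R α)
  Answer-functional fun given refl           refl            = refl
  Answer-functional fun built (e , r , refl) (e′ , r′ , refl) = cong suc (fun r r′)

  Run-functional : Extensionality 0ℓ 0ℓ → ∀ {R} → Functional R → ∀ {h : Index Γ} {a y y′} →
    Run φ R h a y → Run φ R h a y′ → y ≡ y′
  Run-functional ext fun s1           s1             = refl
  Run-functional ext fun s2           s2             = refl
  Run-functional ext fun s3           s3             = refl
  Run-functional ext fun (s4 r t)     (s4 r′ t′) with Run-functional ext fun r r′
  ... | refl = Run-functional ext fun t t′
  Run-functional ext fun (s5-zero r)  (s5-zero r′)   = Run-functional ext fun r r′
  Run-functional ext fun (s5-suc r t) (s5-suc r′ t′) with Run-functional ext fun r r′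
  ... | refl = Run-functional ext fun t t′
  Run-functional ext fun (s6 r)       (s6 r′)        = Run-functional ext fun r r′
  Run-functional ext fun (s8 {α = α} F r t) (s8 F′ r′ t′)
    -- The two runs carry their own query functions; extensionality turns them into one query.
    with ext {f = F} {g = F′} (λ ξ → Run-functional ext fun (r ξ) (r′ ξ))
  ... | refl = Answer-functional fun α t t′
  Run-functional ext fun (s9 d eq r) (s9 d′ eq′ r′) with code-injective d d′ (trans eq (sym eq′))
  ... | refl = Run-functional ext fun r r′

-- The number of the description λ n. h(n, b).
describe : Index (0 ∷ Γ) → All Sym Γ → ℕ
describe h b = ⟪ code h ∷ argCodes b ⟫

-- The oracles enter a description only as symbols, so a number can name it.
Computes : Pure 2 → Rel → Rel
Computes φ R f e =
  ∃[ Γ ] Σ[ h ∈ Index (0 ∷ Γ) ] Σ[ b ∈ All Sym Γ ] (describe h b ≡ e × ∀ n → Run φ R h (n ∷ b) (f n))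

Computes-mono : ∀ {φ R S} → R ⊆ S → Computes φ R ⊆ Computes φ S
Computes-mono R⊆S (Γ , h , b , eq , r) = Γ , h , b , eq , λ n → Run-mono R⊆S (r n)

-- The number decodes to one index and one list of symbolic arguments, and runs over a functional
-- oracle are deterministic.
Computes-injective : Extensionality 0ℓ 0ℓ → ∀ {φ R} → Functional R → ∀ {f f′ e} →
  Computes φ R f e → Computes φ R f′ e → f ≡ f′
Computes-injective ext fun (Γ , h , b , eq , r) (Γ′ , h′ , b′ , eq′ , r′)
  with ∷-injective (⟪⟫-injective (code h ∷ argCodes b) (code h′ ∷ argCodes b′) (trans eq (sym eq′)))
... | p , q with code-fields-injective h h′ p
... | _ , refl , _ with code-injective h h′ p | argCodes-injective b b′ q
... | refl | refl = ext λ n → Run-functional ext fun (r n) (r′ n)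

-- Least numbers and initial segments

Least : (ℕ → Set) → ℕ → Set
Least P n = P n × ∀ {m} → m < n → ¬ P m

Least-unique : ∀ {P m n} → Least P m → Least P n → m ≡ n
Least-unique {m = m} {n} (p , p<) (q , q<) with <-cmp m n
... | tri< m<n _ _ = contradiction p (q< m<n)
... | tri≈ _ m≡n _ = m≡n
... | tri> _ _ n<m = contradiction q (p< n<m)

applyUpTo-injective : ∀ (f g : ℕ → ℕ) n → f ↾ n ≡ g ↾ n → ∀ {i} → i < n → f i ≡ g i
applyUpTo-injective f g (suc n) eq {zero}  _         = ∷-injectiveˡ eq
applyUpTo-injective f g (suc n) eq {suc i} (s<s i<n) =
  applyUpTo-injective (f ∘ suc) (g ∘ suc) n (∷-injectiveʳ eq) i<n

-- Transfinite construction of the oracle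

data Stage : Set where
  start : Stage
  next  : Stage → Stage
  sup   : (ℕ → Stage) → Stage

module Construction (em : ExcludedMiddle 0ℓ) (ext : Extensionality 0ℓ 0ℓ) (φ : Pure 2) where

  least : ∀ {P : ℕ → Set} n → P n → ∃[ m ] Least P m
  least {P} = <-rec _ λ n rec p → case-em n rec p
    where
    case-em : ∀ n → (∀ {m} → m < n → P m → ∃[ k ] Least P k) → P n → ∃[ k ] Least P k
    case-em n rec p with em {∃[ m ] (m < n × P m)}
    ... | yes (m , m<n , q) = rec m<n q
    ... | no none           = n , p , λ m<n q → none (_ , m<n , q)

  Undefined : Rel → (ℕ → ℕ) → Set
  Undefined R f = ¬ (∃[ e ] R f e)

  -- `next` adds all newly computable functions at once and never revises a value, even if a smaller
  -- description appears later.
  Built : Stage → Rel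
  Built start    f e = ⊥
  Built (next s) f e = Built s f e ⊎ (Undefined (Built s) f × Least (Computes φ (Built s) f) e)
  Built (sup α)  f e = ∃[ n ] Built (α n) f e

  infix 4 _≼_
  _≼_ : Stage → Stage → Set
  s ≼ t = Built s ⊆ Built t

  -- Both inclusions enter: being undefined is contravariant in the relation, and a least
  -- description has to remain least.
  next-cong : ∀ {s t} → s ≼ t → t ≼ s → next s ≼ next t
  next-cong s≼t t≼s (inj₁ r)               = inj₁ (s≼t r)
  next-cong s≼t t≼s (inj₂ (u , c , below)) =
    inj₂ ((λ (e , r) → u (e , t≼s r)) , Computes-mono s≼t c , λ m<e d → below m<e (Computes-mono t≼s d))

  -- Excluded middle decides whether a single member of the sequence already contains `u`.
  sup-dichotomy : ∀ {t u} α → (∀ n → α n ≼ t ⊎ u ≼ α n) → sup α ≼ t ⊎ u ≼ sup α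
  sup-dichotomy {u = u} α cmp with em {∃[ n ] u ≼ α n}
  ... | yes (n , u≼) = inj₂ λ r → n , u≼ r
  ... | no none      = inj₁ λ (n , r) → below n (cmp n) r
    where
    below : ∀ {t} n → α n ≼ t ⊎ u ≼ α n → α n ≼ t
    below n (inj₁ ≼t) = ≼t
    below n (inj₂ u≼) = ⊥-elim (none (n , u≼))

  -- Induction on `t` with `s` fixed. In the critical case `s` and `t` have the same relation, and
  -- `next-cong` applies.
  next-linear : ∀ s → (∀ t → s ≼ t ⊎ next t ≼ s) → ∀ t → t ≼ s ⊎ next s ≼ t
  next-linear s cmp start    = inj₁ λ ()
  next-linear s cmp (sup α)  = sup-dichotomy α λ n → next-linear s cmp (α n)
  next-linear s cmp (next t) with cmp t | next-linear s cmp t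
  ... | inj₂ nt≼s | _         = inj₁ nt≼s
  ... | inj₁ _    | inj₂ ns≼t = inj₂ λ r → inj₁ (ns≼t r)
  ... | inj₁ s≼t  | inj₁ t≼s  = inj₂ (next-cong s≼t t≼s)

  -- The comparability argument of the Bourbaki–Witt theorem.
  linear : ∀ s t → s ≼ t ⊎ next t ≼ s
  linear start    t = inj₁ λ ()
  linear (sup α)  t = sup-dichotomy α λ n → linear (α n) t
  linear (next s) t with linear s t | next-linear s (linear s) t
  ... | inj₂ nt≼s | _         = inj₂ λ r → inj₁ (nt≼s r)
  ... | inj₁ _    | inj₂ ns≼t = inj₁ ns≼t
  ... | inj₁ s≼t  | inj₁ t≼s  = inj₂ (next-cong t≼s s≼t)

  Total : Rel
  Total f e = ∃[ s ] Built s f e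

  -- Enlarging the oracle preserves a description; only its minimality is given up.
  Built-computes : ∀ s → Built s ⊆ Computes φ (Built s)
  Built-computes (next s) (inj₁ r)           = Computes-mono inj₁ (Built-computes s r)
  Built-computes (next s) (inj₂ (_ , c , _)) = Computes-mono inj₁ c
  Built-computes (sup α)  (n , r)            = Computes-mono (n ,_) (Built-computes (α n) r)

  -- At a successor only undefined functions receive values; at a limit, linearity brings both
  -- values into one member of the sequence.
  Built-functional : ∀ s → Functional (Built s)
  Built-functional (next s) (inj₁ r)       (inj₁ r′)        = Built-functional s r r′
  Built-functional (next s) (inj₁ r)       (inj₂ (u , _))   = contradiction (_ , r) u
  Built-functional (next s) (inj₂ (u , _)) (inj₁ r)         = contradiction (_ , r) u
  Built-functional (next s) (inj₂ (_ , l)) (inj₂ (_ , l′))  = Least-unique l l′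
  Built-functional (sup α)  (m , r)        (n , r′) with linear (α m) (α n)
  ... | inj₁ m≼n = Built-functional (α n) (m≼n r) r′
  ... | inj₂ n≼m = Built-functional (α m) r (n≼m (inj₁ r′))

  Total-functional : Functional Total
  Total-functional (s , r) (t , r′) with linear s t
  ... | inj₁ s≼t = Built-functional t (s≼t r) r′
  ... | inj₂ t≼s = Built-functional s r (t≼s (inj₁ r′))

  -- Since `e` codes a description over a functional relation, it determines the function; this
  -- makes diagonalising over `e` unambiguous.
  Total-injective : ∀ {f f′ e} → Total f e → Total f′ e → f ≡ f′
  Total-injective (s , r) (t , r′) = Computes-injective ext Total-functional
    (Computes-mono (s ,_) (Built-computes s r)) (Computes-mono (t ,_) (Built-computes t r′))

  Answer-stage : ∀ α {f y} → Answer φ Total α f y → ∃[ s ] Answer φ (Built s) α f y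
  Answer-stage given eq                 = start , eq
  Answer-stage built (e , (s , r) , eq) = s , e , r , eq

  infixr 5 _⊔_
  _⊔_ : Stage → Stage → Stage
  s ⊔ t = sup λ { zero → s ; (suc _) → t }

  ≼-⊔ˡ : ∀ s t → s ≼ s ⊔ t
  ≼-⊔ˡ s t r = 0 , r

  ≼-⊔ʳ : ∀ s t → t ≼ s ⊔ t
  ≼-⊔ʳ s t r = 1 , r

  -- The stage is assembled by recursion on the run: a join for two premises, a countable limit for
  -- the premises of `S8`.
  Run-stage : ∀ {h : Index Γ} {a y} → Run φ Total h a y → ∃[ s ] Run φ (Built s) h a y
  Run-stage s1 = start , s1
  Run-stage s2 = start , s2
  Run-stage s3 = start , s3
  Run-stage (s4 r t) with Run-stage r | Run-stage t
  ... | u , r′ | v , t′ = u ⊔ v , s4 (Run-mono (≼-⊔ˡ u v) r′) (Run-mono (≼-⊔ʳ u v) t′)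
  Run-stage (s5-zero r) with Run-stage r
  ... | u , r′ = u , s5-zero r′
  Run-stage (s5-suc r t) with Run-stage r | Run-stage t
  ... | u , r′ | v , t′ = u ⊔ v , s5-suc (Run-mono (≼-⊔ˡ u v) r′) (Run-mono (≼-⊔ʳ u v) t′)
  Run-stage (s6 r) with Run-stage r
  ... | u , r′ = u , s6 r′
  Run-stage (s8 {α = α} F r t) with Answer-stage α t
  ... | v , t′ = u ⊔ v ,
    s8 F (λ ξ → Run-mono (λ q → ≼-⊔ˡ u v (ξ , q)) (proj₂ (Run-stage (r ξ))))
         (Answer-mono (≼-⊔ʳ u v) α t′)
    where
    u : Stage
    u = sup λ ξ → proj₁ (Run-stage (r ξ))
  Run-stage (s9 d eq r) with Run-stage r
  ... | u , r′ = u , s9 d eq r′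

  Computes-stage : ∀ {f e} → Computes φ Total f e → ∃[ s ] Computes φ (Built s) f e
  Computes-stage (Γ , h , b , eq , r) =
    sup (λ n → proj₁ (Run-stage (r n))) ,
    Γ , h , b , eq , λ n → Run-mono (n ,_) (proj₂ (Run-stage (r n)))

  -- A single stage suffices to compute `f`. If `f` has no value there, the next stage supplies one,
  -- the least number, which may differ from `e`.
  Total-closed : ∀ {f e} → Computes φ Total f e → ∃[ e′ ] Total f e′
  Total-closed {f} c with Computes-stage c
  ... | s , c′ with em {∃[ e′ ] Built s f e′}
  ...   | yes (e′ , r) = e′ , s , r
  ...   | no undefined with least _ c′
  ...     | e′ , l     = e′ , next s , inj₂ (undefined , l)

  -- The total oracle and the simulation of computations

  G : Pure 2
  G f with em {∃[ e ] Total f e}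
  ... | yes (e , _) = suc e
  -- This default is never consulted in a simulated computation: by `Answer-G` every query to
  -- `built` lies in `Total`.
  ... | no _        = 0

  G-value : ∀ {f e} → Total f e → G f ≡ suc e
  G-value {f} r with em {∃[ e ] Total f e}
  ... | yes (_ , r′)  = cong suc (Total-functional r′ r)
  ... | no undefined  = contradiction (_ , r) undefined

  ⟦_⟧ : Sym j → Pure j
  ⟦_⟧ {0} x     = x
  ⟦_⟧ {2} given = φ
  ⟦_⟧ {2} built = G

  map-lookup : (a : All Sym Γ) (p : j ∈ Γ) → All.lookup (All.map ⟦_⟧ a) p ≡ ⟦ All.lookup a p ⟧
  map-lookup (x ∷ a) (here refl) = refl
  map-lookup (x ∷ a) (there p)   = map-lookup a p

  map-─⁺ : (p : j ∈ Γ) (a : All Sym Γ) → ─⁺ p (All.map ⟦_⟧ a) ≡ All.map ⟦_⟧ (─⁺ p a)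
  map-─⁺ (here _)  (x ∷ a) = refl
  map-─⁺ (there p) (x ∷ a) = cong (⟦ x ⟧ ∷_) (map-─⁺ p a)

  map-take⁺ : ∀ n (a : All Sym Γ) → take⁺ n (All.map ⟦_⟧ a) ≡ All.map ⟦_⟧ (take⁺ n a)
  map-take⁺ zero    a       = refl
  map-take⁺ (suc n) []      = refl
  map-take⁺ (suc n) (x ∷ a) = cong (⟦ x ⟧ ∷_) (map-take⁺ n a)

  -- S6 moves the bound variable of S8 to the front.
  Answer-G : ∀ α {F} {h : Index (2 ∷ 0 ∷ Γ)} {b} → (∀ ξ → Run φ Total h (α ∷ ξ ∷ b) (F ξ)) →
    Answer φ Total α F (⟦ α ⟧ F)
  Answer-G given r = refl
  Answer-G built {h = h} {b} r
    with Total-closed (_ , S6 (there (here refl)) h , built ∷ b , refl , λ n → s6 (r n))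
  ... | e , t = e , t , G-value t

  -- At `S8` the induction hypothesis gives runs over `Total` for the query, so `Answer-G` applies.
  -- The equation on `A` leaves the argument list free for matching on the computation.
  simulate : ∀ {h : Index Γ} {A y} → ｛ h ｝ A ≃ y → ∀ a → A ≡ All.map ⟦_⟧ a → Run φ Total h a y
  simulate s1           (x ∷ a) refl = s1
  simulate s2           a       eq   = s2
  simulate s3           (x ∷ a) refl = s3
  simulate (s4 {z = z} r t) a   refl = s4 (simulate r a refl) (simulate t (z ∷ a) refl)
  simulate (s5-zero r)  (zero ∷ a) refl = s5-zero (simulate r a refl)
  simulate (s5-suc {x = x} {z = z} r t) (suc x ∷ a) refl =
    s5-suc (simulate r (x ∷ a) refl) (simulate t (x ∷ z ∷ a) refl)
  simulate (s6 {p = p} r) a     refl =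
    s6 (simulate r (All.lookup a p ∷ ─⁺ p a) (cong₂ _∷_ (map-lookup a p) (map-─⁺ p a)))
  simulate s7           (() ∷ _) _
  simulate (s8 {j = zero} F r)  (α ∷ a) refl = s8 F r′ (Answer-G α r′)
    where
    r′ = λ ξ → simulate (r ξ) (α ∷ ξ ∷ a) refl
  simulate (s8 {j = suc _} F r) (() ∷ a) _
  simulate (s9 {m = m} d eq r) (x ∷ a) refl =
    s9 d eq (simulate r (take⁺ (toℕ m) a) (map-take⁺ (toℕ m) a))

  -- Diagonalisation against the numbered functions

  Diagonal : ℕ → Set
  Diagonal e = ∃[ f ] (Total f e × f e ≡ 0)

  indicator : {P : Set} → Dec P → ℕ
  indicator (yes _) = 1
  indicator (no _)  = 0

  diagonal : ℕ → ℕ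
  diagonal e = indicator (em {Diagonal e})

  diagonal-binary : Binary diagonal
  diagonal-binary e with em {Diagonal e}
  ... | yes _ = s<s z<s
  ... | no _  = z<s

  -- If `Diagonal e` holds, its witness is `f` by `Total-injective`, and 1 meets 0; otherwise `f e`
  -- is nonzero and meets 0.
  diagonal-differs : ∀ {f e} → Total f e → ¬ diagonal e ≡ f e
  diagonal-differs {f} {e} r eq with em {Diagonal e}
  ... | no none           = none (f , r , sym eq)
  ... | yes (g , r′ , g≡0) with Total-injective r r′
  ...   | refl with trans eq g≡0
  ...     | ()

  -- As `G f` is `suc e` rather than `e`, the neighbourhood also fixes the value at `e`, where the
  -- two functions differ.
  diagonal-avoids : ∀ {f e} → Total f e → ¬ diagonal ∈[ f ↾ G f ]
  diagonal-avoids {f} {e} r eq rewrite G-value r =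
    diagonal-differs r (applyUpTo-injective diagonal f (suc e)
      (subst (λ n → diagonal ↾ n ≡ f ↾ suc e) (length-applyUpTo f (suc e)) eq) (n<1+n e))

corollary3p8 : ExcludedMiddle 0ℓ → Extensionality 0ℓ 0ℓ →
    (φ : Pure 2) → ¬ (∃[ Θ ] (SFF Θ × Θ ComputableIn φ))
corollary3p8 em ext φ (Θ , sff , _ , v , v-computes) = diagonal-avoids (proj₂ total) (lookup-index covered)
  where
  open Construction em ext φ

  covered = sff G diagonal diagonal-binary

  i : Fin (length (Θ G))
  i = Any.index covered

  total : ∃[ e ] Total (lookup (Θ G) i) e
  -- `v` takes `i` before `n`, while a description varies its first argument; `S6` swaps them.
  total = Total-closed (_ , S6 (there (here refl)) v , toℕ i ∷ built ∷ given ∷ [] , refl , λ n →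
    s6 (simulate (v-computes G i n) (toℕ i ∷ n ∷ built ∷ given ∷ []) refl))
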